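{- Let $x$ be a label and let $A,B$ be bi-intuitionistic formulae. If the labelled sequent $\vdash x:A\supset B$ is provable in the calculus $\mathsf{BiIntL}$, then there exists a bi-intuitionistic formula $C$ such that (i) $var(C)\subseteq var(A)\cap var(B)$ and (ii) $\vdash x:A\supset C$ and $\vdash x:C\supset B$ are both provable in $\mathsf{BiIntL}$.
   Context: Bi-intuitionistic formulae over a countable set of propositional variables $p$: $A::=p\mid\top\mid\bot\mid A\wedge A\mid A\vee A\mid A\supset A\mid A\prec A$, where $\prec$ denotes the exclusion (subtraction) connective, dual to $\supset$. $var(A)$ is the set of propositional variables occurring in $A$. Labels come from a countable set. A labelled sequent is $\mathcal R,\Gamma\vdash\Delta$ with $\mathcal R$ a finite multiset of relational atoms $Rxy$ ($x,y$ labels) and $\Gamma,\Delta$ finite multisets of labelled formulae $x:A$. The calculus $\mathsf{BiIntL}$. Initial sequents: $\mathcal R,x:p,\Gamma\vdash\Delta,x:p$; $\ \mathcal R,\Gamma\vdash x:\top,\Delta$; $\ \mathcal R,\Gamma,x:\bot\vdash\Delta$. Rules: ($\vee_L$) from $\mathcal R,\Gamma,x:A\vdash\Delta$ and $\mathcal R,\Gamma,x:B\vdash\Delta$ infer $\mathcal R,\Gamma,x:A\vee B\vdash\Delta$; ($\vee_R$) from $\mathcal R,\Gamma\vdash x:A,x:B,\Delta$ infer $\mathcal R,\Gamma\vdash x:A\vee B,\Delta$; ($\wedge_L$) from $\mathcal R,\Gamma,x:A,x:B\vdash\Delta$ infer $\mathcal R,\Gamma,x:A\wedge B\vdash\Delta$;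 ($\wedge_R$) from $\mathcal R,\Gamma\vdash x:A,\Delta$ and $\mathcal R,\Gamma\vdash x:B,\Delta$ infer $\mathcal R,\Gamma\vdash x:A\wedge B,\Delta$; ($monl$) from $\mathcal R,Rxy,x:A,y:A,\Gamma\vdash\Delta$ infer $\mathcal R,Rxy,x:A,\Gamma\vdash\Delta$; ($monr$) from $\mathcal R,Rxy,\Gamma\vdash x:A,y:A,\Delta$ infer $\mathcal R,Rxy,\Gamma\vdash y:A,\Delta$; ($\supset_L$) from $\mathcal R,x:A\supset B,\Gamma\vdash x:A,\Delta$ and $\mathcal R,x:B,\Gamma\vdash\Delta$ infer $\mathcal R,x:A\supset B,\Gamma\vdash\Delta$; ($\supset_R$) from $\mathcal R,Rxy,\Gamma,y:A\vdash y:B,\Delta$ infer $\mathcal R,\Gamma\vdash x:A\supset B,\Delta$, provided $y$ does not occur in the conclusion; ($\prec_L$) from $\mathcal R,Ryx,y:A,\Gamma\vdash y:B,\Delta$ infer $\mathcal R,x:A\prec B,\Gamma\vdash\Delta$, provided $y$ does not occur in the conclusion; ($\prec_R$) from $\mathcal R,\Gamma\vdash x:A,\Delta$ and $\mathcal R,x:B,\Gamma\vdash x:A\prec B,\Delta$ infer $\mathcal R,\Gamma\vdash x:A\prec B,\Delta$. -}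

module Defs where

open import Data.List.Base using (List; []; _∷_; _++_; concatMap; map)
open import Data.List.Membership.Propositional using (_∉_)
open import Data.List.Relation.Binary.Permutation.Propositional using (_↭_)
open import Data.Nat.Base using (ℕ)
open import Level using (0ℓ)
open import Relation.Unary using (Pred; ∅; ｛_｝; _∪_)

infix  20 R_,_
infixr 9 _∧_
infixr 8 _∨_
infixr 7 _⊃_
infixl 7 _≺_
infix  6 _∶_
infix  3 _∣_⊢_

PropVar : Set
PropVar = ℕ

Label : Set
Label = ℕ

data Formula : Set where
  atom : PropVar → Formula
  ⊤ ⊥  : Formula
  _∧_ _∨_ _⊃_ _≺_ : Formula → Formula → Formula

var : Formula → Pred PropVar 0ℓ
var (atom p) = ｛ p ｝
var ⊤        = ∅
var ⊥        = ∅
var (A ∧ B)  = var A ∪ var B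
var (A ∨ B)  = var A ∪ var B
var (A ⊃ B)  = var A ∪ var B
var (A ≺ B)  = var A ∪ var B

data RelAtom : Set where
  R_,_ : Label → Label → RelAtom

data LabelledFormula : Set where
  _∶_ : Label → Formula → LabelledFormula

-- Finite multisets are represented by lists; the order of the entries is
-- made irrelevant by the rule `exchange` of `Provable` below.
data Sequent : Set where
  _∣_⊢_ : List RelAtom → List LabelledFormula → List LabelledFormula → Sequent

relLabels : RelAtom → List Label
relLabels (R x , y) = x ∷ y ∷ []

label : LabelledFormula → Label
label (x ∶ A) = x

labels : Sequent → List Label
labels (ℛ ∣ Γ ⊢ Δ) = concatMap relLabels ℛ ++ map label Γ ++ map label Δ

private
  variable
    x y : Label
    p   : PropVar
    A B : Formula
    ℛ ℛ′ : List RelAtom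
    Γ Γ′ Δ Δ′ : List LabelledFormula

-- Provability in BiIntL.  Apart from `exchange`, which identifies lists that
-- represent the same multiset, there are no structural rules.
data Provable : Sequent → Set where

  exchange : ℛ ↭ ℛ′ → Γ ↭ Γ′ → Δ ↭ Δ′ →
             Provable (ℛ ∣ Γ ⊢ Δ) →
             Provable (ℛ′ ∣ Γ′ ⊢ Δ′)

  id   : Provable (ℛ ∣ x ∶ atom p ∷ Γ ⊢ x ∶ atom p ∷ Δ)

  ⊤R   : Provable (ℛ ∣ Γ ⊢ x ∶ ⊤ ∷ Δ)

  ⊥L   : Provable (ℛ ∣ x ∶ ⊥ ∷ Γ ⊢ Δ)

  ∨L   : Provable (ℛ ∣ x ∶ A ∷ Γ ⊢ Δ) →
         Provable (ℛ ∣ x ∶ B ∷ Γ ⊢ Δ) →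
         Provable (ℛ ∣ x ∶ A ∨ B ∷ Γ ⊢ Δ)

  ∨R   : Provable (ℛ ∣ Γ ⊢ x ∶ A ∷ x ∶ B ∷ Δ) →
         Provable (ℛ ∣ Γ ⊢ x ∶ A ∨ B ∷ Δ)

  ∧L   : Provable (ℛ ∣ x ∶ A ∷ x ∶ B ∷ Γ ⊢ Δ) →
         Provable (ℛ ∣ x ∶ A ∧ B ∷ Γ ⊢ Δ)

  ∧R   : Provable (ℛ ∣ Γ ⊢ x ∶ A ∷ Δ) →
         Provable (ℛ ∣ Γ ⊢ x ∶ B ∷ Δ) →
         Provable (ℛ ∣ Γ ⊢ x ∶ A ∧ B ∷ Δ)

  monl : Provable (R x , y ∷ ℛ ∣ x ∶ A ∷ y ∶ A ∷ Γ ⊢ Δ) →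
         Provable (R x , y ∷ ℛ ∣ x ∶ A ∷ Γ ⊢ Δ)

  monr : Provable (R x , y ∷ ℛ ∣ Γ ⊢ x ∶ A ∷ y ∶ A ∷ Δ) →
         Provable (R x , y ∷ ℛ ∣ Γ ⊢ y ∶ A ∷ Δ)

  ⊃L   : Provable (ℛ ∣ x ∶ A ⊃ B ∷ Γ ⊢ x ∶ A ∷ Δ) →
         Provable (ℛ ∣ x ∶ B ∷ Γ ⊢ Δ) →
         Provable (ℛ ∣ x ∶ A ⊃ B ∷ Γ ⊢ Δ)

  ⊃R   : y ∉ labels (ℛ ∣ Γ ⊢ x ∶ A ⊃ B ∷ Δ) →
         Provable (R x , y ∷ ℛ ∣ y ∶ A ∷ Γ ⊢ y ∶ B ∷ Δ) →
         Provable (ℛ ∣ Γ ⊢ x ∶ A ⊃ B ∷ Δ)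

  ≺L   : y ∉ labels (ℛ ∣ x ∶ A ≺ B ∷ Γ ⊢ Δ) →
         Provable (R y , x ∷ ℛ ∣ y ∶ A ∷ Γ ⊢ y ∶ B ∷ Δ) →
         Provable (ℛ ∣ x ∶ A ≺ B ∷ Γ ⊢ Δ)

  ≺R   : Provable (ℛ ∣ Γ ⊢ x ∶ A ∷ Δ) →
         Provable (ℛ ∣ x ∶ B ∷ Γ ⊢ x ∶ A ≺ B ∷ Δ) →
         Provable (ℛ ∣ Γ ⊢ x ∶ A ≺ B ∷ Δ)

{-# OPTIONS --safe #-}
module Submission where

-- Maehara's method on labelled derivations, without cut.  The interpolant of a sequent split in two
-- is a classical conjunction of clauses of signed labelled formulae: every clause is provable on the
-- first side, and every choice of one literal from each clause, with its sign reversed, is provable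
-- on the second.  The two sides are interchanged by passing to the transversals of the clauses, so
-- only principal formulae on one side need attention.  At an eigenvariable rule the literals of a
-- clause at the eigenvariable are folded into a single ⊃ or ≺ formula at its neighbour; the clauses
-- that remain at the root become a conjunction of implications.

open import Defs
open import Data.Empty using (⊥-elim)
open import Data.List.Base using (List; []; _∷_; [_]; _++_; map; concatMap; cartesianProductWith)
open import Data.List.Extrema.Nat using (max; xs≤max)
open import Data.List.Membership.Propositional using (_∈_; _∉_; find; lose)
open import Data.List.Membership.Propositional.Properties using (∈-∃++; ∈-map⁻; ∈-++⁺ˡ; ∈-++⁺ʳ)
open import Data.List.Relation.Binary.Permutation.Propositional
  using (_↭_; ↭-refl; ↭-sym; ↭-trans; prep; swap)
open import Data.List.Relation.Binary.Permutation.Propositional.Properties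
  using (shift; ∈-resp-↭; All-resp-↭; ↭-empty-inv; ↭-singleton-inv)
import Data.List.Relation.Binary.Subset.Propositional as List⊆
open import Data.List.Relation.Unary.All as All using (All; []; _∷_)
import Data.List.Relation.Unary.All.Properties as All
open import Data.List.Relation.Unary.Any as Any using (Any; here; there)
import Data.List.Relation.Unary.Any.Properties as Any
open import Data.Nat.Base using (zero; suc)
open import Data.Nat.Properties using (_≟_; 1+n≰n; 1+n≢n)
open import Data.Product.Base using (_×_; _,_; proj₁; proj₂; ∃-syntax)
import Data.Product.Base as Product
open import Data.Sum.Base as Sum using (_⊎_; inj₁; inj₂)
open import Function.Base using (_∘_; const)
open import Level using (0ℓ)
open import Relation.Binary.Core using (Rel)
open import Relation.Binary.Construct.Closure.ReflexiveTransitive using (Star; ε; _◅_; _◅◅_)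
import Relation.Binary.Construct.Closure.ReflexiveTransitive as Star
open import Relation.Binary.PropositionalEquality using (_≡_; _≢_; refl; sym; subst; subst₂)
open import Relation.Nullary using (yes; no)
open import Relation.Unary using (Pred; _⊆_; _∩_; _∪_; ｛_｝; ∅)

infix 2 _⊩_

-- Signed labelled formulae.

data Sign : Set where
  left right : Sign

dual : Sign → Sign
dual left  = right
dual right = left

Literal : Set
Literal = Sign × LabelledFormula

Clause : Set
Clause = List Literal

opposite : Literal → Literal
opposite (s , φ) = dual s , φ

-- `op s` is the connective whose rule at sign `s` introduces an eigenvariable; its rule at `dual s`
-- introduces no label.
op : Sign → Formula → Formula → Formula
op left  = _≺_
op right = _⊃_

private
  variable
    f        : Label → Label
    s        : Sign
    x y      : Label
    A B      : Formula
    φ        : LabelledFormula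
    ℛ ℛ′    : List RelAtom
    Γ Γ′ Δ Δ′ : List LabelledFormula
    E E′     : Rel Label 0ℓ
    Θ Σ₁ Σ₂ Φ Ψ : Pred Literal 0ℓ
    V₁ V₂    : Pred PropVar 0ℓ
    P Q      : List Clause

extract : ∀ {X : Set} {z : X} {zs} → z ∈ zs → ∃[ ws ] zs ↭ z ∷ ws
extract i with ys , zs , refl ← ∈-∃++ i = ys ++ zs , shift _ ys zs

fresh : (xs : List Label) → ∃[ y ] y ∉ xs
fresh xs = suc (max 0 xs) , λ i → 1+n≰n (All.lookup (xs≤max 0 xs) i)

-- Covering of literals by sequents.

Reach : List RelAtom → Rel Label 0ℓ
Reach ℛ = Star λ a b → (R a , b) ∈ ℛ

-- A literal is covered by a sequent if it, or a trace of its decomposition along some branch, occurs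
-- there up to monotonicity.  The cases follow the rules that consume their principal formula, hence
-- the absence of a case for the premises of ⊃L and ≺R that retain it.
data Cover (ℛ : List RelAtom) (Γ Δ : List LabelledFormula) : Pred Literal 0ℓ where
  memˡ : Reach ℛ x y → x ∶ A ∈ Γ → Cover ℛ Γ Δ (left , y ∶ A)
  memʳ : Reach ℛ y x → x ∶ A ∈ Δ → Cover ℛ Γ Δ (right , y ∶ A)
  ∧ˡ   : Cover ℛ Γ Δ (left , x ∶ A) → Cover ℛ Γ Δ (left , x ∶ B) →
         Cover ℛ Γ Δ (left , x ∶ A ∧ B)
  ∧ʳ₁  : Cover ℛ Γ Δ (right , x ∶ A) → Cover ℛ Γ Δ (right , x ∶ A ∧ B)
  ∧ʳ₂  : Cover ℛ Γ Δ (right , x ∶ B) → Cover ℛ Γ Δ (right , x ∶ A ∧ B)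
  ∨ˡ₁  : Cover ℛ Γ Δ (left , x ∶ A) → Cover ℛ Γ Δ (left , x ∶ A ∨ B)
  ∨ˡ₂  : Cover ℛ Γ Δ (left , x ∶ B) → Cover ℛ Γ Δ (left , x ∶ A ∨ B)
  ∨ʳ   : Cover ℛ Γ Δ (right , x ∶ A) → Cover ℛ Γ Δ (right , x ∶ B) →
         Cover ℛ Γ Δ (right , x ∶ A ∨ B)
  ⊃ˡ   : Cover ℛ Γ Δ (left , x ∶ B) → Cover ℛ Γ Δ (left , x ∶ A ⊃ B)
  ⊃ʳ   : Reach ℛ x y → Cover ℛ Γ Δ (left , y ∶ A) → Cover ℛ Γ Δ (right , y ∶ B) →
         Cover ℛ Γ Δ (right , x ∶ A ⊃ B)
  ≺ˡ   : Reach ℛ y x → Cover ℛ Γ Δ (left , y ∶ A) → Cover ℛ Γ Δ (right , y ∶ B) →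
         Cover ℛ Γ Δ (left , x ∶ A ≺ B)
  ≺ʳ   : Cover ℛ Γ Δ (right , x ∶ A) → Cover ℛ Γ Δ (right , x ∶ A ≺ B)

Cover-monˡ : Reach ℛ x y → Cover ℛ Γ Δ (left , x ∶ A) → Cover ℛ Γ Δ (left , y ∶ A)
Cover-monˡ p (memˡ q i)  = memˡ (q ◅◅ p) i
Cover-monˡ p (∧ˡ c d)    = ∧ˡ (Cover-monˡ p c) (Cover-monˡ p d)
Cover-monˡ p (∨ˡ₁ c)     = ∨ˡ₁ (Cover-monˡ p c)
Cover-monˡ p (∨ˡ₂ c)     = ∨ˡ₂ (Cover-monˡ p c)
Cover-monˡ p (⊃ˡ c)      = ⊃ˡ (Cover-monˡ p c)
Cover-monˡ p (≺ˡ q c d)  = ≺ˡ (q ◅◅ p) c d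

Cover-monʳ : Reach ℛ x y → Cover ℛ Γ Δ (right , y ∶ A) → Cover ℛ Γ Δ (right , x ∶ A)
Cover-monʳ p (memʳ q i)  = memʳ (p ◅◅ q) i
Cover-monʳ p (∧ʳ₁ c)     = ∧ʳ₁ (Cover-monʳ p c)
Cover-monʳ p (∧ʳ₂ c)     = ∧ʳ₂ (Cover-monʳ p c)
Cover-monʳ p (∨ʳ c d)    = ∨ʳ (Cover-monʳ p c) (Cover-monʳ p d)
Cover-monʳ p (⊃ʳ q c d)  = ⊃ʳ (p ◅◅ q) c d
Cover-monʳ p (≺ʳ c)      = ≺ʳ (Cover-monʳ p c)

-- Covers are built from members, so covering the members again is enough. Hence a premise whose
-- principal formula was consumed still covers all that the conclusion did.
Cover-trans : ℛ List⊆.⊆ ℛ′ →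
              (∀ {φ} → φ ∈ Γ → Cover ℛ′ Γ′ Δ′ (left , φ)) →
              (∀ {φ} → φ ∈ Δ → Cover ℛ′ Γ′ Δ′ (right , φ)) →
              Cover ℛ Γ Δ ⊆ Cover ℛ′ Γ′ Δ′
Cover-trans {ℛ = ℛ} {ℛ′ = ℛ′} {Γ = Γ} {Γ′ = Γ′} {Δ′ = Δ′} {Δ = Δ} r l k = go
  where
  path : Reach ℛ x y → Reach ℛ′ x y
  path = Star.map r
  go : Cover ℛ Γ Δ ⊆ Cover ℛ′ Γ′ Δ′
  go (memˡ p i)  = Cover-monˡ (path p) (l i)
  go (memʳ p i)  = Cover-monʳ (path p) (k i)
  go (∧ˡ c d)    = ∧ˡ (go c) (go d)
  go (∧ʳ₁ c)     = ∧ʳ₁ (go c)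
  go (∧ʳ₂ c)     = ∧ʳ₂ (go c)
  go (∨ˡ₁ c)     = ∨ˡ₁ (go c)
  go (∨ˡ₂ c)     = ∨ˡ₂ (go c)
  go (∨ʳ c d)    = ∨ʳ (go c) (go d)
  go (⊃ˡ c)      = ⊃ˡ (go c)
  go (⊃ʳ p c d)  = ⊃ʳ (path p) (go c) (go d)
  go (≺ˡ p c d)  = ≺ˡ (path p) (go c) (go d)
  go (≺ʳ c)      = ≺ʳ (go c)

coveredˡ : φ ∈ Γ → Cover ℛ Γ Δ (left , φ)
coveredˡ {_ ∶ _} = memˡ ε

coveredʳ : φ ∈ Δ → Cover ℛ Γ Δ (right , φ)
coveredʳ {_ ∶ _} = memʳ ε

-- Monotonicity along paths.

monl-∈ : (R x , y) ∈ ℛ → x ∶ A ∈ Γ →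
         Provable (ℛ ∣ y ∶ A ∷ Γ ⊢ Δ) → Provable (ℛ ∣ Γ ⊢ Δ)
monl-∈ e i d with _ , σ ← extract e | _ , τ ← extract i =
  exchange (↭-sym σ) (↭-sym τ) ↭-refl
    (monl (exchange σ (↭-trans (prep _ τ) (swap _ _ ↭-refl)) ↭-refl d))

monr-∈ : (R x , y) ∈ ℛ → y ∶ A ∈ Δ →
         Provable (ℛ ∣ Γ ⊢ x ∶ A ∷ Δ) → Provable (ℛ ∣ Γ ⊢ Δ)
monr-∈ e i d with _ , σ ← extract e | _ , τ ← extract i =
  exchange (↭-sym σ) ↭-refl (↭-sym τ)
    (monr (exchange σ ↭-refl (prep _ τ) d))

-- One `monl` per edge; the continuation form hides how many intermediate copies were added.
walkˡ : Reach ℛ x y → x ∶ A ∈ Γ →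
        (∀ {Γ′} → Γ List⊆.⊆ Γ′ → y ∶ A ∈ Γ′ → Provable (ℛ ∣ Γ′ ⊢ Δ)) →
        Provable (ℛ ∣ Γ ⊢ Δ)
walkˡ ε       i k = k (λ j → j) i
walkˡ (e ◅ p) i k = monl-∈ e i (walkˡ p (here refl) (λ sub → k (sub ∘ there)))

walkʳ : Reach ℛ y x → x ∶ A ∈ Δ →
        (∀ {Δ′} → Δ List⊆.⊆ Δ′ → y ∶ A ∈ Δ′ → Provable (ℛ ∣ Γ ⊢ Δ′)) →
        Provable (ℛ ∣ Γ ⊢ Δ)
walkʳ ε       i k = k (λ j → j) i
-- `monr` moves a formula from the target of an edge to its source, so the tail of the path is
-- walked first.
walkʳ (e ◅ p) i k = walkʳ p i (λ sub j → monr-∈ e j (k (there ∘ sub) (here refl)))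

principalˡ : Reach ℛ x y → x ∶ A ∈ Γ →
             (∀ {Γ′} → Γ List⊆.⊆ (y ∶ A ∷ Γ′) → Provable (ℛ ∣ y ∶ A ∷ Γ′ ⊢ Δ)) →
             Provable (ℛ ∣ Γ ⊢ Δ)
principalˡ p i k = walkˡ p i λ sub j → let _ , σ = extract j in
  exchange ↭-refl (↭-sym σ) ↭-refl (k (∈-resp-↭ σ ∘ sub))

principalʳ : Reach ℛ y x → x ∶ A ∈ Δ →
             (∀ {Δ′} → Δ List⊆.⊆ (y ∶ A ∷ Δ′) → Provable (ℛ ∣ Γ ⊢ y ∶ A ∷ Δ′)) →
             Provable (ℛ ∣ Γ ⊢ Δ)
principalʳ p i k = walkʳ p i λ sub j → let _ , σ = extract j in
  exchange ↭-refl ↭-refl (↭-sym σ) (k (∈-resp-↭ σ ∘ sub))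

splitHead : {P : Pred LabelledFormula 0ℓ} → Γ List⊆.⊆ (φ ∷ Γ′) → P φ → (∀ {ψ} → ψ ∈ Γ′ → P ψ) →
            ∀ {ψ} → ψ ∈ Γ → P ψ
splitHead sub p ps i with sub i
... | here refl = p
... | there j   = ps j

-- Derived rules for covered literals.

relabel : (Label → Label) → Literal → Literal
relabel f (s , x ∶ A) = s , f x ∶ A

-- Quantifying over all covering sequents makes weakening, contraction and relabelling immediate,
-- although none of them is a rule of the calculus.
record _⊩_ (E : Rel Label 0ℓ) (Θ : Pred Literal 0ℓ) : Set where
  constructor entails
  field
    prove : ∀ (f : Label → Label) {ℛ Γ Δ} →
            (∀ {a b} → E a b → Reach ℛ (f a) (f b)) →
            (∀ {l} → Θ l → Cover ℛ Γ Δ (relabel f l)) →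
            Provable (ℛ ∣ Γ ⊢ Δ)
open _⊩_

⊩-relabel : (g : Label → Label) → (∀ {a b} → E a b → Star E′ (g a) (g b)) →
            (∀ {l} → Θ l → Φ (relabel g l)) → E ⊩ Θ → E′ ⊩ Φ
⊩-relabel g e t d .prove f e′ t′ =
  d .prove (f ∘ g) (Star.kleisliStar f e′ ∘ e) λ { {_ , _ ∶ _} → t′ ∘ t }

⊩-id : ∀ {p} → Θ (left , x ∶ atom p) → Θ (right , x ∶ atom p) → E ⊩ Θ
⊩-id l r .prove f _ t with t l | t r
-- Atoms leave no traces, so both literals come from members. `p` ends where `q` starts, and the
-- composite path carries the left occurrence to the right one.
... | memˡ p i | memʳ q j = walkˡ (p ◅◅ q) i λ _ i′ →
  let _ , σ = extract i′; _ , τ = extract j in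
  exchange ↭-refl (↭-sym σ) (↭-sym τ) id

⊩-⊤R : Θ (right , x ∶ ⊤) → E ⊩ Θ
⊩-⊤R r .prove f _ t with memʳ p i ← t r = principalʳ p i λ _ → ⊤R

⊩-⊥L : Θ (left , x ∶ ⊥) → E ⊩ Θ
⊩-⊥L l .prove f _ t with memˡ p i ← t l = principalˡ p i λ _ → ⊥L

add : ∀ {f l} → Cover ℛ Γ Δ (relabel f l) → (∀ {m} → Θ m → Cover ℛ Γ Δ (relabel f m)) →
      ∀ {m} → (｛ l ｝ ∪ Θ) m → Cover ℛ Γ Δ (relabel f m)
add c t (inj₁ refl) = c
add c t (inj₂ θ)    = t θ

add₂ : ∀ {f l m} → Cover ℛ Γ Δ (relabel f l) → Cover ℛ Γ Δ (relabel f m) →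
       (∀ {n} → Θ n → Cover ℛ Γ Δ (relabel f n)) →
       ∀ {n} → ((｛ l ｝ ∪ ｛ m ｝) ∪ Θ) n → Cover ℛ Γ Δ (relabel f n)
add₂ c c′ t (inj₁ (inj₁ refl)) = c
add₂ c c′ t (inj₁ (inj₂ refl)) = c′
add₂ c c′ t (inj₂ θ)           = t θ

-- The premise keeps all of `Θ`, so contraction is built in. A trace of the principal formula
-- already covers the added literals, and no rule is applied; a member is consumed by `∧L`, and the
-- trace it leaves keeps `Θ` covered. The rules down to `⊩-≺R` follow this pattern, a trace
-- selecting one premise where there are two.
⊩-∧L : Θ (left , x ∶ A ∧ B) → E ⊩ (｛ left , x ∶ A ｝ ∪ ｛ left , x ∶ B ｝) ∪ Θ → E ⊩ Θ
⊩-∧L l d .prove f e t with t l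
... | ∧ˡ c c′  = d .prove f e (add₂ c c′ t)
... | memˡ p i = principalˡ p i λ sub → ∧L (d .prove f e
  (add₂ (coveredˡ (here refl)) (coveredˡ (there (here refl)))
    (Cover-trans (λ j → j)
      (splitHead sub (∧ˡ (coveredˡ (here refl)) (coveredˡ (there (here refl))))
                     (coveredˡ ∘ there ∘ there))
      coveredʳ ∘ t)))

⊩-∨R : Θ (right , x ∶ A ∨ B) → E ⊩ (｛ right , x ∶ A ｝ ∪ ｛ right , x ∶ B ｝) ∪ Θ → E ⊩ Θ
⊩-∨R r d .prove f e t with t r
... | ∨ʳ c c′  = d .prove f e (add₂ c c′ t)
... | memʳ p i = principalʳ p i λ sub → ∨R (d .prove f e
  (add₂ (coveredʳ (here refl)) (coveredʳ (there (here refl)))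
    (Cover-trans (λ j → j) coveredˡ
      (splitHead sub (∨ʳ (coveredʳ (here refl)) (coveredʳ (there (here refl))))
                     (coveredʳ ∘ there ∘ there)) ∘ t)))

⊩-∨L : Θ (left , x ∶ A ∨ B) → E ⊩ ｛ left , x ∶ A ｝ ∪ Θ → E ⊩ ｛ left , x ∶ B ｝ ∪ Θ → E ⊩ Θ
⊩-∨L l d d′ .prove f e t with t l
... | ∨ˡ₁ c    = d .prove f e (add c t)
... | ∨ˡ₂ c    = d′ .prove f e (add c t)
... | memˡ p i = principalˡ p i λ sub → ∨L
  (d .prove f e (add (coveredˡ (here refl)) (Cover-trans (λ j → j)
    (splitHead sub (∨ˡ₁ (coveredˡ (here refl))) (coveredˡ ∘ there)) coveredʳ ∘ t)))
  (d′ .prove f e (add (coveredˡ (here refl)) (Cover-trans (λ j → j)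
    (splitHead sub (∨ˡ₂ (coveredˡ (here refl))) (coveredˡ ∘ there)) coveredʳ ∘ t)))

⊩-∧R : Θ (right , x ∶ A ∧ B) → E ⊩ ｛ right , x ∶ A ｝ ∪ Θ → E ⊩ ｛ right , x ∶ B ｝ ∪ Θ → E ⊩ Θ
⊩-∧R r d d′ .prove f e t with t r
... | ∧ʳ₁ c    = d .prove f e (add c t)
... | ∧ʳ₂ c    = d′ .prove f e (add c t)
... | memʳ p i = principalʳ p i λ sub → ∧R
  (d .prove f e (add (coveredʳ (here refl)) (Cover-trans (λ j → j) coveredˡ
    (splitHead sub (∧ʳ₁ (coveredʳ (here refl))) (coveredʳ ∘ there)) ∘ t)))
  (d′ .prove f e (add (coveredʳ (here refl)) (Cover-trans (λ j → j) coveredˡ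
    (splitHead sub (∧ʳ₂ (coveredʳ (here refl))) (coveredʳ ∘ there)) ∘ t)))

⊩-⊃L : Θ (left , x ∶ A ⊃ B) → E ⊩ ｛ right , x ∶ A ｝ ∪ Θ → E ⊩ ｛ left , x ∶ B ｝ ∪ Θ → E ⊩ Θ
⊩-⊃L l d d′ .prove f e t with t l
... | ⊃ˡ c     = d′ .prove f e (add c t)
... | memˡ p i = principalˡ p i λ sub → ⊃L
  (d .prove f e (add (coveredʳ (here refl)) (Cover-trans (λ j → j)
    (coveredˡ ∘ sub) (coveredʳ ∘ there) ∘ t)))
  (d′ .prove f e (add (coveredˡ (here refl)) (Cover-trans (λ j → j)
    (splitHead sub (⊃ˡ (coveredˡ (here refl))) (coveredˡ ∘ there)) coveredʳ ∘ t)))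

⊩-≺R : Θ (right , x ∶ A ≺ B) → E ⊩ ｛ right , x ∶ A ｝ ∪ Θ → E ⊩ ｛ left , x ∶ B ｝ ∪ Θ → E ⊩ Θ
⊩-≺R r d d′ .prove f e t with t r
... | ≺ʳ c     = d .prove f e (add c t)
... | memʳ p i = principalʳ p i λ sub → ≺R
  (d .prove f e (add (coveredʳ (here refl)) (Cover-trans (λ j → j) coveredˡ
    (splitHead sub (≺ʳ (coveredʳ (here refl))) (coveredʳ ∘ there)) ∘ t)))
  (d′ .prove f e (add (coveredˡ (here refl)) (Cover-trans (λ j → j)
    (coveredˡ ∘ there) (coveredʳ ∘ sub) ∘ t)))

⊩-op : ∀ s → Θ (dual s , x ∶ op s A B) →
       E ⊩ ｛ right , x ∶ A ｝ ∪ Θ → E ⊩ ｛ left , x ∶ B ｝ ∪ Θ → E ⊩ Θ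
⊩-op left  = ⊩-≺R
⊩-op right = ⊩-⊃L

-- No rule of the calculus is applied here: covering is itself closed under monotonicity.
⊩-monl : E x y → Θ (left , x ∶ A) → E ⊩ ｛ left , y ∶ A ｝ ∪ Θ → E ⊩ Θ
⊩-monl r l d .prove f e t = d .prove f e (add (Cover-monˡ (e r) (t l)) t)

⊩-monr : E x y → Θ (right , y ∶ A) → E ⊩ ｛ right , x ∶ A ｝ ∪ Θ → E ⊩ Θ
⊩-monr r l d .prove f e t = d .prove f e (add (Cover-monʳ (e r) (t l)) t)

-- Labels of E and Θ are de Bruijn indices: a fresh label is 0 and the old labels move up by one.
data Extend (E : Rel Label 0ℓ) : Sign → Label → Rel Label 0ℓ where
  old  : E x y → ∀ {s z} → Extend E s z (suc x) (suc y)
  up   : Extend E right x (suc x) zero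
  down : Extend E left x zero (suc x)

Shift : Pred Literal 0ℓ → Pred Literal 0ℓ
Shift Θ (s , zero ∶ A)  = ∅ A
Shift Θ (s , suc x ∶ A) = Θ (s , x ∶ A)

Fresh : Formula → Formula → Pred Literal 0ℓ → Pred Literal 0ℓ
Fresh A B Θ = (｛ left , zero ∶ A ｝ ∪ ｛ right , zero ∶ B ｝) ∪ Shift Θ

_▸_ : (Label → Label) → Label → Label → Label
(f ▸ y) zero    = y
(f ▸ y) (suc x) = f x

shiftCover : ∀ {f} → (∀ {l} → Θ l → Cover ℛ Γ Δ (relabel f l)) →
             ∀ {l} → Shift Θ l → Cover ℛ Γ Δ (relabel (f ▸ y) l)
shiftCover t {_ , suc _ ∶ _} = t

Towards : List RelAtom → Sign → Rel Label 0ℓ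
Towards ℛ left  x y = Reach ℛ y x
Towards ℛ right x y = Reach ℛ x y

extendReach : ∀ {f} → (∀ {a b} → E a b → Reach ℛ (f a) (f b)) → Towards ℛ s (f x) y →
              ∀ {a b} → Extend E s x a b → Reach ℛ ((f ▸ y) a) ((f ▸ y) b)
extendReach e p (old r) = e r
extendReach e p up      = p
extendReach e p down    = p

-- A trace of the principal formula records a label at which its parts are covered, and index 0 is
-- sent there; a member calls for a label that is really fresh. Both cases fit because `prove`
-- accepts any map from indices to labels, injective or not.
⊩-fresh : ∀ s → Θ (s , x ∶ op s A B) → Extend E s x ⊩ Fresh A B Θ → E ⊩ Θ
⊩-fresh {Θ} {x} {A} {B} right r d .prove f {ℛ} {Γ} {Δ} e t with t r
... | ⊃ʳ p c c′ = d .prove (f ▸ _) (extendReach e p) (add₂ c c′ (shiftCover t))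
... | memʳ p i  = principalʳ p i λ {Δ′} sub →
  let y , y∉ = fresh (labels (ℛ ∣ Γ ⊢ f x ∶ A ⊃ B ∷ Δ′))
      new = Star.return (here refl) in
  ⊃R y∉ (d .prove (f ▸ y) (extendReach (Star.map there ∘ e) new)
    (add₂ (coveredˡ (here refl)) (coveredʳ (here refl)) (shiftCover {Θ}
      (Cover-trans there (coveredˡ ∘ there)
        (splitHead sub (⊃ʳ new (coveredˡ (here refl)) (coveredʳ (here refl)))
                       (coveredʳ ∘ there)) ∘ t))))
⊩-fresh {Θ} {x} {A} {B} left l d .prove f {ℛ} {Γ} {Δ} e t with t l
... | ≺ˡ p c c′ = d .prove (f ▸ _) (extendReach e p) (add₂ c c′ (shiftCover t))
... | memˡ p i  = principalˡ p i λ {Γ′} sub →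
  let y , y∉ = fresh (labels (ℛ ∣ f x ∶ A ≺ B ∷ Γ′ ⊢ Δ))
      new = Star.return (here refl) in
  ≺L y∉ (d .prove (f ▸ y) (extendReach (Star.map there ∘ e) new)
    (add₂ (coveredˡ (here refl)) (coveredʳ (here refl)) (shiftCover {Θ}
      (Cover-trans there
        (splitHead sub (≺ˡ new (coveredˡ (here refl)) (coveredʳ (here refl)))
                       (coveredˡ ∘ there)) (coveredʳ ∘ there) ∘ t))))

-- Clausal interpolants.

formula : Literal → Formula
formula (_ , _ ∶ A) = A

Over : Pred PropVar 0ℓ → Pred Literal 0ℓ
Over V l = var (formula l) ⊆ V

Refutes : Pred Literal 0ℓ → Pred Clause 0ℓ
Refutes Θ = Any (Θ ∘ opposite)

-- The interpolant is the conjunction of its clauses; a clause is the disjunction of its literals,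
-- where (left , x ∶ C) stands for the classical negation of C at x.
record Interpolant (V₁ V₂ : Pred PropVar 0ℓ) (E : Rel Label 0ℓ) (Σ₁ Σ₂ : Pred Literal 0ℓ) : Set₁ where
  field
    clauses : List Clause
    over    : All (All (Over (V₁ ∩ V₂))) clauses
    proof₁  : ∀ {Θ} → Σ₁ ⊆ Θ → Any (All Θ) clauses → E ⊩ Θ
    proof₂  : ∀ {Θ} → Σ₂ ⊆ Θ → All (Refutes Θ) clauses → E ⊩ Θ
open Interpolant

-- Disjunction of two conjunctions of clauses, by distributivity.
_⊔_ : List Clause → List Clause → List Clause
_⊔_ = cartesianProductWith _++_

module _ {p} {R : Pred Literal p} where

  ⊔-All⁺ : All (All R) P → All (All R) Q → All (All R) (P ⊔ Q)
  ⊔-All⁺ []       rs = []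
  ⊔-All⁺ (q ∷ qs) rs = All.++⁺ (All.map⁺ (All.map (All.++⁺ q) rs)) (⊔-All⁺ qs rs)

  ⊔-All⁻ : ∀ P → Any (All R) (P ⊔ Q) → Any (All R) P × Any (All R) Q
  ⊔-All⁻ {Q} (c ∷ P) h with Any.++⁻ (map (c ++_) Q) h
  ... | inj₂ h′ = Product.map₁ there (⊔-All⁻ P h′)
  ... | inj₁ h′ with h″ ← Any.map⁻ h′ =
    here (All.++⁻ˡ c (proj₂ (Any.satisfied h″))) , Any.map (All.++⁻ʳ c) h″

  -- For a fixed `c` in `P`, each `c ++ d` is hit in `c` or in `d`: either some hit lies in `c`, or
  -- every `d` in `Q` is hit.
  ⊔-Any⁻ : ∀ P → All (Any R) (P ⊔ Q) → All (Any R) P ⊎ All (Any R) Q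
  ⊔-Any⁻ []      h = inj₁ []
  ⊔-Any⁻ {Q} (c ∷ P) h with All.++⁻ (map (c ++_) Q) h
  ... | h₁ , h₂ with ⊔-Any⁻ P h₂ | distribute (All.map (Any.++⁻ c) (All.map⁻ h₁))
    where
    distribute : ∀ {X : Set p} {S : Pred Clause p} {Q} → All (λ c → X ⊎ S c) Q → X ⊎ All S Q
    distribute []            = inj₂ []
    distribute (inj₁ r ∷ _)  = inj₁ r
    distribute (inj₂ q ∷ qs) = Sum.map₂ (q ∷_) (distribute qs)
  ...   | inj₂ qs | _       = inj₂ qs
  ...   | inj₁ _  | inj₂ qs = inj₂ qs
  ...   | inj₁ ps | inj₁ r  = inj₁ (r ∷ ps)

-- The clause form of the negation. The empty conjunction is true, so its negation is the single
-- empty clause.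
transversals : List Clause → List Clause
transversals []      = [] ∷ []
transversals (c ∷ P) = map ([_] ∘ opposite) c ⊔ transversals P

transversals-Refutes : ∀ P → Any (All Θ) (transversals P) → All (Refutes Θ) P
transversals-Refutes []      h = []
transversals-Refutes (c ∷ P) h with ⊔-All⁻ (map ([_] ∘ opposite) c) h
... | h₁ , h₂ = Any.map All.head (Any.map⁻ h₁) ∷ transversals-Refutes P h₂

Refutes-transversals : ∀ P → All (Refutes Θ) (transversals P) → Any (All Θ) P
Refutes-transversals []      (() ∷ _)
Refutes-transversals {Θ} (c ∷ P) h with ⊔-Any⁻ (map ([_] ∘ opposite) c) h
... | inj₁ h₁ = here (All.map undual (All.map⁻ h₁))
  where
  undual : ∀ {l} → Refutes Θ [ opposite l ] → Θ l
  undual {left  , _} (here θ) = θ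
  undual {right , _} (here θ) = θ
... | inj₂ h₂ = there (Refutes-transversals P h₂)

transversals-Over : ∀ {V} → All (All (Over V)) P → All (All (Over V)) (transversals P)
transversals-Over []       = [] ∷ []
transversals-Over {V = V} (o ∷ os) =
  ⊔-All⁺ (All.map⁺ (All.map (λ { {_ , _ ∶ _} v → v ∷ [] }) o)) (transversals-Over os)

-- Negation interchanges the two proof obligations: a transversal inside `Θ` refutes every clause,
-- and refuting all transversals puts some clause wholly inside `Θ`.
exchangeSides : Interpolant V₁ V₂ E Σ₁ Σ₂ → Interpolant V₂ V₁ E Σ₂ Σ₁
exchangeSides I .clauses = transversals (I .clauses)
exchangeSides I .over = transversals-Over
  (All.map (All.map (λ { {_ , _ ∶ _} v o → Product.swap (v o) })) (I .over))
exchangeSides I .proof₁ sub h = I .proof₂ sub (transversals-Refutes (I .clauses) h)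
exchangeSides I .proof₂ sub h = I .proof₁ sub (Refutes-transversals (I .clauses) h)

-- The interpolant is falsity, the empty clause, which nothing refutes.
closed : (∀ {Θ} → Σ₁ ⊆ Θ → E ⊩ Θ) → Interpolant V₁ V₂ E Σ₁ Σ₂
closed d .clauses          = [] ∷ []
closed d .over             = [] ∷ []
closed d .proof₁ sub _     = d sub
closed d .proof₂ _ (() ∷ _)

shared : ∀ {p} → V₁ p → V₂ p → Σ₁ (left , x ∶ atom p) → Σ₂ (right , x ∶ atom p) →
         Interpolant V₁ V₂ E Σ₁ Σ₂
shared {x = x} {p = p} v₁ v₂ l r .clauses = [ [ right , x ∶ atom p ] ]
shared v₁ v₂ l r .over = ((λ { refl → v₁ , v₂ }) ∷ []) ∷ []
shared v₁ v₂ l r .proof₁ sub (here (θ ∷ [])) = ⊩-id (sub l) θ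
shared v₁ v₂ l r .proof₂ sub (here θ ∷ []) = ⊩-id θ (sub r)

extend : (∀ {Θ} → Σ₁ ⊆ Θ → E ⊩ Φ ∪ Θ → E ⊩ Θ) →
         Interpolant V₁ V₂ E (Φ ∪ Σ₁) Σ₂ → Interpolant V₁ V₂ E Σ₁ Σ₂
extend rule I .clauses      = I .clauses
extend rule I .over         = I .over
extend rule I .proof₁ sub h =
  rule sub (I .proof₁ (Sum.map₂ sub) (Any.map (All.map inj₂) h))
extend rule I .proof₂       = I .proof₂

-- The interpolant is the disjunction. Each of its clauses contains a clause for either premise,
-- while refuting all of them refutes one of the two interpolants entirely.
branch : (∀ {Θ} → Σ₁ ⊆ Θ → E ⊩ Φ ∪ Θ → E ⊩ Ψ ∪ Θ → E ⊩ Θ) →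
         Interpolant V₁ V₂ E (Φ ∪ Σ₁) Σ₂ → Interpolant V₁ V₂ E (Ψ ∪ Σ₁) Σ₂ →
         Interpolant V₁ V₂ E Σ₁ Σ₂
branch rule I J .clauses      = I .clauses ⊔ J .clauses
branch rule I J .over         = ⊔-All⁺ (I .over) (J .over)
branch rule I J .proof₁ sub h with ⊔-All⁻ (I .clauses) h
... | h₁ , h₂ = rule sub (I .proof₁ (Sum.map₂ sub) (Any.map (All.map inj₂) h₁))
                         (J .proof₁ (Sum.map₂ sub) (Any.map (All.map inj₂) h₂))
branch rule I J .proof₂ sub h = Sum.[ I .proof₂ sub , J .proof₂ sub ] (⊔-Any⁻ (I .clauses) h)

-- Folding the literals at an eigenvariable.

antecedent succedent : Clause → Formula
antecedent []                      = ⊤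
antecedent ((left , zero ∶ A) ∷ c) = A ∧ antecedent c
antecedent (_ ∷ c)                 = antecedent c
succedent []                       = ⊥
succedent ((right , zero ∶ A) ∷ c) = A ∨ succedent c
succedent (_ ∷ c)                  = succedent c

lower : Clause → Clause
lower []                    = []
lower ((s , zero ∶ A) ∷ c)  = lower c
lower ((s , suc x ∶ A) ∷ c) = (s , x ∶ A) ∷ lower c

module _ {V : Pred PropVar 0ℓ} where

  antecedent-var : ∀ c → All (Over V) c → var (antecedent c) ⊆ V
  antecedent-var ((left  , zero  ∶ A) ∷ c) (v ∷ vs) = Sum.[ v , antecedent-var c vs ]
  antecedent-var ((right , zero  ∶ A) ∷ c) (v ∷ vs) = antecedent-var c vs
  antecedent-var ((left  , suc x ∶ A) ∷ c) (v ∷ vs) = antecedent-var c vs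
  antecedent-var ((right , suc x ∶ A) ∷ c) (v ∷ vs) = antecedent-var c vs

  succedent-var : ∀ c → All (Over V) c → var (succedent c) ⊆ V
  succedent-var ((right , zero  ∶ A) ∷ c) (v ∷ vs) = Sum.[ v , succedent-var c vs ]
  succedent-var ((left  , zero  ∶ A) ∷ c) (v ∷ vs) = succedent-var c vs
  succedent-var ((left  , suc x ∶ A) ∷ c) (v ∷ vs) = succedent-var c vs
  succedent-var ((right , suc x ∶ A) ∷ c) (v ∷ vs) = succedent-var c vs

  lower-Over : ∀ c → All (Over V) c → All (Over V) (lower c)
  lower-Over []                    []       = []
  lower-Over ((s , zero ∶ A) ∷ c)  (v ∷ vs) = lower-Over c vs
  lower-Over ((s , suc x ∶ A) ∷ c) (v ∷ vs) = v ∷ lower-Over c vs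

lower-Refutes : ∀ c → Refutes Θ (lower c) → Refutes (Shift Θ) c
lower-Refutes ((s , zero ∶ A) ∷ c)  h         = there (lower-Refutes c h)
lower-Refutes ((s , suc x ∶ A) ∷ c) (here θ)  = here θ
lower-Refutes ((s , suc x ∶ A) ∷ c) (there h) = there (lower-Refutes c h)

Shift-mono : Θ ⊆ Φ → Shift Θ ⊆ Shift Φ
Shift-mono sub {_ , suc _ ∶ _} = sub

Fresh-mono : Θ ⊆ Φ → Fresh A B Θ ⊆ Fresh A B Φ
Fresh-mono sub {l} = Sum.map₂ (Shift-mono sub {l})

-- `⊩-∧L` and `⊩-∨R` take the folded formulae apart without branching and restore each literal at
-- index 0 with its own sign; `lower c` supplies the others.
assume : ∀ c {Θ Φ} → Φ (left , zero ∶ antecedent c) → Φ (right , zero ∶ succedent c) →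
         Shift Θ ⊆ Φ → All Θ (lower c) →
         (∀ {Ψ} → Φ ⊆ Ψ → All Ψ c → E ⊩ Ψ) → E ⊩ Φ
assume [] l r sub θs k = k (λ θ → θ) []
assume ((left , zero ∶ A) ∷ c) l r sub θs k = ⊩-∧L l
  (assume c (inj₁ (inj₂ refl)) (inj₂ r) (inj₂ ∘ sub) θs
    λ sub′ ψs → k (sub′ ∘ inj₂) (sub′ (inj₁ (inj₁ refl)) ∷ ψs))
assume ((right , zero ∶ A) ∷ c) l r sub θs k = ⊩-∨R r
  (assume c (inj₂ l) (inj₁ (inj₂ refl)) (inj₂ ∘ sub) θs
    λ sub′ ψs → k (sub′ ∘ inj₂) (sub′ (inj₁ (inj₁ refl)) ∷ ψs))
assume ((left  , suc x ∶ A) ∷ c) l r sub (θ ∷ θs) k =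
  assume c l r sub θs λ sub′ ψs → k sub′ (sub′ (sub θ) ∷ ψs)
assume ((right , suc x ∶ A) ∷ c) l r sub (θ ∷ θs) k =
  assume c l r sub θs λ sub′ ψs → k sub′ (sub′ (sub θ) ∷ ψs)

-- Each conjunct gets a branch where it stands on the right, as the opposite of a literal of `c`;
-- the branch that remains ends at `⊤`. `refute-succedent` is dual.
refute-antecedent : ∀ c {Θ} → Θ (right , zero ∶ antecedent c) →
                    (∀ {Ψ} → Θ ⊆ Ψ → Refutes Ψ c → E ⊩ Ψ) → E ⊩ Θ
refute-antecedent [] r k = ⊩-⊤R r
refute-antecedent ((left , zero ∶ A) ∷ c) r k = ⊩-∧R r (k inj₂ (here (inj₁ refl)))
  (refute-antecedent c (inj₁ refl) λ sub h → k (sub ∘ inj₂) (there h))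
refute-antecedent ((right , zero  ∶ A) ∷ c) r k = refute-antecedent c r λ sub → k sub ∘ there
refute-antecedent ((left  , suc x ∶ A) ∷ c) r k = refute-antecedent c r λ sub → k sub ∘ there
refute-antecedent ((right , suc x ∶ A) ∷ c) r k = refute-antecedent c r λ sub → k sub ∘ there

refute-succedent : ∀ c {Θ} → Θ (left , zero ∶ succedent c) →
                   (∀ {Ψ} → Θ ⊆ Ψ → Refutes Ψ c → E ⊩ Ψ) → E ⊩ Θ
refute-succedent [] l k = ⊩-⊥L l
refute-succedent ((right , zero ∶ A) ∷ c) l k = ⊩-∨L l (k inj₂ (here (inj₁ refl)))
  (refute-succedent c (inj₁ refl) λ sub h → k (sub ∘ inj₂) (there h))
refute-succedent ((left  , zero  ∶ A) ∷ c) l k = refute-succedent c l λ sub → k sub ∘ there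
refute-succedent ((left  , suc x ∶ A) ∷ c) l k = refute-succedent c l λ sub → k sub ∘ there
refute-succedent ((right , suc x ∶ A) ∷ c) l k = refute-succedent c l λ sub → k sub ∘ there

-- Classically, the literals of `c` at index 0 amount to an implication from `antecedent c` to
-- `succedent c`. As a literal of sign `s`, the folded formula says that this implication holds at
-- every label above (`⊃`) or below (`≺`) its own.
opClause : Sign → Clause → Formula
opClause s c = op s (antecedent c) (succedent c)

opClause-var : ∀ {V} s c → All (Over V) c → var (opClause s c) ⊆ V
opClause-var left  c vs = Sum.[ antecedent-var c vs , succedent-var c vs ]
opClause-var right c vs = Sum.[ antecedent-var c vs , succedent-var c vs ]

-- At the dual sign a folded formula is decomposed without a new label: one premise refutes its
-- clause through the antecedent, the other through the succedent. So all clauses can be treated at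
-- the same index 0, where `step` brings the formulae.
refute-all : ∀ s {y} →
             (∀ {C Θ} → Θ (dual s , y ∶ C) → E ⊩ ｛ dual s , zero ∶ C ｝ ∪ Θ → E ⊩ Θ) →
             ∀ P {Θ} → All (λ c → Refutes Θ c ⊎ Θ (dual s , y ∶ opClause s c)) P →
             (∀ {Ψ} → Θ ⊆ Ψ → All (Refutes Ψ) P → E ⊩ Ψ) → E ⊩ Θ
refute-all s step []      []            k = k (λ θ → θ) []
refute-all s step (c ∷ P) (inj₁ h ∷ hs) k =
  refute-all s step P hs λ sub hs′ → k sub (Any.map sub h ∷ hs′)
refute-all {E} s step (c ∷ P) {Θ} (inj₂ θ ∷ hs) k =
  step θ (⊩-op s (inj₁ refl)
    (refute-antecedent c (inj₁ refl) λ sub → rest (sub ∘ inj₂ ∘ inj₂))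
    (refute-succedent c (inj₁ refl) λ sub → rest (sub ∘ inj₂ ∘ inj₂)))
  where
  rest : ∀ {Ψ} → Θ ⊆ Ψ → Refutes Ψ c → E ⊩ Ψ
  rest sub h = refute-all s step P (All.map (Sum.map (Any.map sub) sub) hs)
    λ sub′ hs′ → k (sub′ ∘ sub) (Any.map sub′ h ∷ hs′)

-- Left formulae are inherited upwards and right ones downwards, which is where `Extend E s x`
-- places the new label.
⊩-descend : ∀ s → Θ (dual s , suc x ∶ A) →
            Extend E s x ⊩ ｛ dual s , zero ∶ A ｝ ∪ Θ → Extend E s x ⊩ Θ
⊩-descend left  = ⊩-monr down
⊩-descend right = ⊩-monl up

-- The principal formula belongs to the second side, but both sides need the eigenvariable. The
-- first obtains it by decomposing the folded literal of a clause; the second obtains it from the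
-- principal formula, and then refutes the folded formulae of all clauses at that one label.
foldFresh₂ : ∀ s → Σ₂ (s , x ∶ op s A B) →
             Interpolant V₁ V₂ (Extend E s x) (Shift Σ₁) (Fresh A B Σ₂) →
             Interpolant V₁ V₂ E Σ₁ Σ₂
foldFresh₂ {x = x} s r I .clauses = map (λ c → (s , x ∶ opClause s c) ∷ lower c) (I .clauses)
foldFresh₂ s r I .over = All.map⁺
  (All.map (λ {c} vs → opClause-var s c vs ∷ lower-Over c vs) (I .over))
foldFresh₂ s r I .proof₁ sub h with find (Any.map⁻ h)
... | c , i , θ ∷ θs = ⊩-fresh s θ
  (assume c (inj₁ (inj₁ refl)) (inj₁ (inj₂ refl)) inj₂ θs
    λ sub′ ψs → I .proof₁ (λ {l} → sub′ ∘ inj₂ ∘ Shift-mono sub {l}) (lose i ψs))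
foldFresh₂ {x = x} {A = A} {B = B} s r I .proof₂ {Θ} sub hs = ⊩-fresh s (sub r)
  (refute-all s (⊩-descend s) (I .clauses) (All.map lift (All.map⁻ hs))
    λ sub′ → I .proof₂ (sub′ ∘ Fresh-mono sub))
  where
  lift : ∀ {c} → Refutes Θ ((s , x ∶ opClause s c) ∷ lower c) →
         Refutes (Fresh A B Θ) c ⊎ Fresh A B Θ (dual s , suc x ∶ opClause s c)
  lift     (here θ)  = inj₂ (inj₂ θ)
  lift {c} (there h) = inj₁ (Any.map inj₂ (lower-Refutes c h))

foldFresh₁ : ∀ s → Σ₁ (s , x ∶ op s A B) →
             Interpolant V₁ V₂ (Extend E s x) (Fresh A B Σ₁) (Shift Σ₂) →
             Interpolant V₁ V₂ E Σ₁ Σ₂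
foldFresh₁ s l = exchangeSides ∘ foldFresh₂ s l ∘ exchangeSides

-- Interpolation by induction on derivations.

Owned : Pred PropVar 0ℓ → Pred Literal 0ℓ → Pred Literal 0ℓ
Owned V Σ l = Σ l × Over V l

data Placed (V₁ V₂ : Pred PropVar 0ℓ) (Σ₁ Σ₂ : Pred Literal 0ℓ) (l : Literal) : Set where
  in₁ : Owned V₁ Σ₁ l → Placed V₁ V₂ Σ₁ Σ₂ l
  in₂ : Owned V₂ Σ₂ l → Placed V₁ V₂ Σ₁ Σ₂ l

swapPlaced : Placed V₁ V₂ Σ₁ Σ₂ ⊆ Placed V₂ V₁ Σ₂ Σ₁
swapPlaced (in₁ o) = in₂ o
swapPlaced (in₂ o) = in₁ o

InRelation : Rel Label 0ℓ → (Label → Label) → Pred RelAtom 0ℓ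
InRelation E f (R a , b) = E (f a) (f b)

-- `f` sends the labels of the derivation to indices and may identify them. Only inclusion in the
-- sides is asked, so they may keep formulae that have been consumed.
record Split (V₁ V₂ : Pred PropVar 0ℓ) (E : Rel Label 0ℓ) (Σ₁ Σ₂ : Pred Literal 0ℓ)
             (f : Label → Label) (ℛ : List RelAtom) (Γ Δ : List LabelledFormula) : Set where
  constructor split
  field
    edges  : All (InRelation E f) ℛ
    lefts  : All (λ φ → Placed V₁ V₂ Σ₁ Σ₂ (relabel f (left , φ))) Γ
    rights : All (λ φ → Placed V₁ V₂ Σ₁ Σ₂ (relabel f (right , φ))) Δ

open Split

-- `k` is uniform in the sides, so a principal formula on the second side is treated by
-- interchanging them.
principalIn₁ : ∀ {f s} →
  (∀ {V₁ V₂ Σ₁ Σ₂} → Split V₁ V₂ E Σ₁ Σ₂ f ℛ Γ Δ → Owned V₁ Σ₁ (relabel f (s , φ)) →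
   Interpolant V₁ V₂ E Σ₁ Σ₂) →
  Split V₁ V₂ E Σ₁ Σ₂ f ℛ Γ Δ → Placed V₁ V₂ Σ₁ Σ₂ (relabel f (s , φ)) → Interpolant V₁ V₂ E Σ₁ Σ₂
principalIn₁ k sp (in₁ o) = k sp o
principalIn₁ k (split e l r) (in₂ o) =
  exchangeSides (k (split e (All.map swapPlaced l) (All.map swapPlaced r)) o)

grow : Placed V₁ V₂ Σ₁ Σ₂ ⊆ Placed V₁ V₂ (Φ ∪ Σ₁) Σ₂
grow (in₁ (m , v)) = in₁ (inj₂ m , v)
grow (in₂ o)       = in₂ o

grows : ∀ {X : Set} {g : X → Literal} {xs} → All (Placed V₁ V₂ Σ₁ Σ₂ ∘ g) xs →
        All (Placed V₁ V₂ (Φ ∪ Σ₁) Σ₂ ∘ g) xs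
grows = All.map grow

new : ∀ {l} → Over V₁ l → Placed V₁ V₂ (｛ l ｝ ∪ Σ₁) Σ₂ l
new v = in₁ (inj₁ refl , v)

newˡ : ∀ {l m} → Over V₁ l → Placed V₁ V₂ ((｛ l ｝ ∪ ｛ m ｝) ∪ Σ₁) Σ₂ l
newˡ v = in₁ (inj₁ (inj₁ refl) , v)

newʳ : ∀ {l m} → Over V₁ m → Placed V₁ V₂ ((｛ l ｝ ∪ ｛ m ｝) ∪ Σ₁) Σ₂ m
newʳ v = in₁ (inj₁ (inj₂ refl) , v)

_[_≔0] : (Label → Label) → Label → Label → Label
(f [ y ≔0]) z with z ≟ y
... | yes _ = zero
... | no  _ = suc (f z)

≔0-same : ∀ f y → zero ≡ (f [ y ≔0]) y
≔0-same f y with y ≟ y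
... | yes _   = refl
... | no  y≢y = ⊥-elim (y≢y refl)

≔0-other : ∀ f {y z} → y ≢ z → suc (f z) ≡ (f [ y ≔0]) z
≔0-other f {y} {z} y≢z with z ≟ y
... | yes z≡y = ⊥-elim (y≢z (sym z≡y))
... | no  _   = refl

freshPlaced : ∀ {f y} → y ∉ map label Γ →
              All (λ φ → Placed V₁ V₂ Σ₁ Σ₂ (relabel f (s , φ))) Γ →
              All (λ φ → Placed V₁ V₂ (Fresh A B Σ₁) (Shift Σ₂) (relabel (f [ y ≔0]) (s , φ))) Γ
freshPlaced y∉ [] = []
freshPlaced {Γ = x ∶ C ∷ _} {V₁} {V₂} {Σ₁} {Σ₂} {s} {A} {B} {f} {y} y∉ (p ∷ ps) =
  subst (λ z → Placed _ _ _ _ (s , z ∶ C)) (≔0-other f (y∉ ∘ here))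
    (lift p) ∷
  freshPlaced (y∉ ∘ there) ps
  where
  lift : Placed V₁ V₂ Σ₁ Σ₂ (s , f x ∶ C) →
         Placed V₁ V₂ (Fresh A B Σ₁) (Shift Σ₂) (s , suc (f x) ∶ C)
  lift (in₁ (m , v)) = in₁ (inj₂ m , v)
  lift (in₂ o)       = in₂ o

freshEdges : ∀ {f y z} → y ∉ concatMap relLabels ℛ →
             All (InRelation E f) ℛ →
             All (InRelation (Extend E s z) (f [ y ≔0])) ℛ
freshEdges y∉ [] = []
freshEdges {ℛ = (R a , b) ∷ _} {f = f} y∉ (e ∷ es) =
  subst₂ (Extend _ _ _) (≔0-other f (y∉ ∘ here)) (≔0-other f (y∉ ∘ there ∘ here)) (old e) ∷
  freshEdges (y∉ ∘ there ∘ there) es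

∉-labels : ∀ ℛ Γ Δ → y ∉ labels (ℛ ∣ Γ ⊢ Δ) →
           y ∉ concatMap relLabels ℛ × y ∉ map label Γ × y ∉ map label Δ
∉-labels ℛ Γ Δ y∉ = y∉ ∘ ∈-++⁺ˡ , y∉ ∘ ∈-++⁺ʳ (concatMap relLabels ℛ) ∘ ∈-++⁺ˡ ,
  y∉ ∘ ∈-++⁺ʳ (concatMap relLabels ℛ) ∘ ∈-++⁺ʳ (map label Γ)

freshSplit : ∀ {f} → y ∉ labels (ℛ ∣ Γ ⊢ Δ) → var A ⊆ V₁ → var B ⊆ V₁ →
             Split V₁ V₂ E Σ₁ Σ₂ f ℛ Γ Δ →
             Split V₁ V₂ (Extend E s x) (Fresh A B Σ₁) (Shift Σ₂) (f [ y ≔0])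
                   ℛ (y ∶ A ∷ Γ) (y ∶ B ∷ Δ)
freshSplit {ℛ = ℛ} {Γ = Γ} {Δ = Δ} {A = A} {B = B} {f = f} y∉ v w (split e l r)
  with y∉ℛ , y∉Γ , y∉Δ ← ∉-labels ℛ Γ Δ y∉ = split (freshEdges y∉ℛ e)
  (subst (λ z → Placed _ _ _ _ (left , z ∶ A)) (≔0-same f _) (newˡ v) ∷ freshPlaced y∉Γ l)
  (subst (λ z → Placed _ _ _ _ (right , z ∶ B)) (≔0-same f _) (newʳ w) ∷ freshPlaced y∉Δ r)

interpolate : ∀ {f} → Provable (ℛ ∣ Γ ⊢ Δ) → Split V₁ V₂ E Σ₁ Σ₂ f ℛ Γ Δ →
              Interpolant V₁ V₂ E Σ₁ Σ₂
interpolate (exchange ρ σ τ d) (split e l r) = interpolate d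
  (split (All-resp-↭ (↭-sym ρ) e) (All-resp-↭ (↭-sym σ) l) (All-resp-↭ (↭-sym τ) r))
interpolate id sp = principalIn₁ (λ where
    -- Occurrences on one side make that side provable alone; on different sides, the variable
    -- bounds in `Owned` place the atom in both `V₁` and `V₂`.
    (split _ _ (in₁ (r , _) ∷ _)) (l , _) → closed λ sub → ⊩-id (sub l) (sub r)
    (split _ _ (in₂ (r , w) ∷ _)) (l , v) → shared (v refl) (w refl) l r)
  sp (All.head (sp .lefts))
interpolate ⊤R sp =
  principalIn₁ (λ _ (m , _) → closed λ sub → ⊩-⊤R (sub m)) sp (All.head (sp .rights))
interpolate ⊥L sp =
  principalIn₁ (λ _ (m , _) → closed λ sub → ⊩-⊥L (sub m)) sp (All.head (sp .lefts))
interpolate (∨L d d′) sp = principalIn₁ (λ { (split e (_ ∷ ls) rs) (m , v) →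
    branch (λ sub → ⊩-∨L (sub m))
      (interpolate d  (split e (new (v ∘ inj₁) ∷ grows ls) (grows rs)))
      (interpolate d′ (split e (new (v ∘ inj₂) ∷ grows ls) (grows rs))) })
  sp (All.head (sp .lefts))
interpolate (∧R d d′) sp = principalIn₁ (λ { (split e ls (_ ∷ rs)) (m , v) →
    branch (λ sub → ⊩-∧R (sub m))
      (interpolate d  (split e (grows ls) (new (v ∘ inj₁) ∷ grows rs)))
      (interpolate d′ (split e (grows ls) (new (v ∘ inj₂) ∷ grows rs))) })
  sp (All.head (sp .rights))
interpolate (⊃L d d′) sp = principalIn₁ (λ { (split e (l ∷ ls) rs) (m , v) →
    branch (λ sub → ⊩-⊃L (sub m))
      (interpolate d  (split e (grows (l ∷ ls)) (new (v ∘ inj₁) ∷ grows rs)))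
      (interpolate d′ (split e (new (v ∘ inj₂) ∷ grows ls) (grows rs))) })
  sp (All.head (sp .lefts))
interpolate (≺R d d′) sp = principalIn₁ (λ { (split e ls (r ∷ rs)) (m , v) →
    branch (λ sub → ⊩-≺R (sub m))
      (interpolate d  (split e (grows ls) (new (v ∘ inj₁) ∷ grows rs)))
      (interpolate d′ (split e (new (v ∘ inj₂) ∷ grows ls) (grows (r ∷ rs)))) })
  sp (All.head (sp .rights))
interpolate (∧L d) sp = principalIn₁ (λ { (split e (_ ∷ ls) rs) (m , v) →
    extend (λ sub → ⊩-∧L (sub m))
      (interpolate d (split e
        (newˡ (v ∘ inj₁) ∷ newʳ (v ∘ inj₂) ∷ grows ls) (grows rs))) })
  sp (All.head (sp .lefts))
interpolate (∨R d) sp = principalIn₁ (λ { (split e ls (_ ∷ rs)) (m , v) →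
    extend (λ sub → ⊩-∨R (sub m))
      (interpolate d (split e
        (grows ls) (newˡ (v ∘ inj₁) ∷ newʳ (v ∘ inj₂) ∷ grows rs))) })
  sp (All.head (sp .rights))
interpolate (monl d) sp = principalIn₁ (λ { (split (e ∷ es) (l ∷ ls) rs) (m , v) →
    extend (λ sub → ⊩-monl e (sub m))
      (interpolate d (split (e ∷ es) (grow l ∷ new v ∷ grows ls) (grows rs))) })
  sp (All.head (sp .lefts))
interpolate (monr d) sp = principalIn₁ (λ { (split (e ∷ es) ls (r ∷ rs)) (m , v) →
    extend (λ sub → ⊩-monr e (sub m))
      (interpolate d (split (e ∷ es) (grows ls) (new v ∷ grow r ∷ grows rs))) })
  sp (All.head (sp .rights))
interpolate {ℛ} {Γ} {Δ} {f = f} (⊃R y∉ d) sp = principalIn₁ (λ sp′ (m , v) →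
    let split es ls rs = freshSplit y∉ (v ∘ inj₁) (v ∘ inj₂) sp′
        y≢x = proj₂ (proj₂ (∉-labels ℛ Γ Δ y∉)) ∘ here
        e = subst₂ (Extend _ _ _) (≔0-other f y≢x) (≔0-same f _) up in
    -- `freshSplit` keeps the principal formula beneath the new literal, but the premise has dropped
    -- it.
    foldFresh₁ right m (interpolate d (split (e ∷ es) ls (All.head rs ∷ All.tail (All.tail rs)))))
  sp (All.head (sp .rights))
interpolate {ℛ} {Γ} {Δ} {f = f} (≺L y∉ d) sp = principalIn₁ (λ sp′ (m , v) →
    let split es ls rs = freshSplit y∉ (v ∘ inj₁) (v ∘ inj₂) sp′
        y≢x = proj₁ (proj₂ (∉-labels ℛ Γ Δ y∉)) ∘ here
        e = subst₂ (Extend _ _ _) (≔0-same f _) (≔0-other f y≢x) down in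
    foldFresh₁ left m (interpolate d (split (e ∷ es) (All.head ls ∷ All.tail (All.tail ls)) rs)))
  sp (All.head (sp .lefts))

-- From clauses to a formula.

conjunction : List Clause → Formula
conjunction []      = ⊤
conjunction (c ∷ P) = opClause right c ∧ conjunction P

conjunction-var : ∀ {V} → All (All (Over V)) P → var (conjunction P) ⊆ V
conjunction-var {c ∷ P} (v ∷ vs) = Sum.[ opClause-var right c v , conjunction-var vs ]

assume-conjunction : ∀ P {Θ} → Θ (left , x ∶ conjunction P) →
                     (∀ {Ψ} → Θ ⊆ Ψ → All (λ c → Ψ (left , x ∶ opClause right c)) P → E ⊩ Ψ) →
                     E ⊩ Θ
assume-conjunction []      l k = k (λ θ → θ) []
assume-conjunction (c ∷ P) l k = ⊩-∧L l (assume-conjunction P (inj₁ (inj₂ refl))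
  λ sub ψs → k (sub ∘ inj₂) (sub (inj₁ (inj₁ refl)) ∷ ψs))

prove-conjunction : ∀ P {Θ} → Θ (right , x ∶ conjunction P) →
                    (∀ {c Ψ} → c ∈ P → Θ ⊆ Ψ → Ψ (right , x ∶ opClause right c) → E ⊩ Ψ) →
                    E ⊩ Θ
prove-conjunction []      r k = ⊩-⊤R r
prove-conjunction (c ∷ P) r k = ⊩-∧R r (k (here refl) inj₂ (inj₁ refl))
  (prove-conjunction P (inj₁ refl) λ i sub → k (there i) (sub ∘ inj₂))

collapse : Clause → Clause
collapse = map (relabel (const zero))

-- Collapsing puts every literal at index 0, so the implication folded from a clause accounts for
-- the whole clause.
lower-collapse : ∀ c → All Θ (lower (collapse c))
lower-collapse []                = []
lower-collapse ((_ , _ ∶ _) ∷ c) = lower-collapse c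

collapse-Over : ∀ {V c} → All (Over V) c → All (Over V) (collapse c)
collapse-Over []                        = []
collapse-Over {c = (_ , _ ∶ _) ∷ _} (v ∷ vs) = v ∷ collapse-Over vs

⊩⇒Provable : _≡_ ⊩ ｛ left , zero ∶ A ｝ ∪ ｛ right , zero ∶ B ｝ →
             Provable ([] ∣ [] ⊢ [ x ∶ A ⊃ B ])
⊩⇒Provable {x = x} d = ⊃R {y = suc x} (λ { (here eq) → 1+n≢n eq })
  (d .prove (const (suc x)) (λ _ → ε) λ where
    (inj₁ refl) → coveredˡ (here refl)
    (inj₂ refl) → coveredʳ (here refl))

-- With no relational atom and no formula on the left, only `exchange` and `⊃R` can end in this
-- sequent.
⊃R-inv : Provable ([] ∣ [] ⊢ [ x ∶ A ⊃ B ]) →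
         ∃[ y ] Provable ([ R x , y ] ∣ [ y ∶ A ] ⊢ [ y ∶ B ])
⊃R-inv (exchange ρ σ τ d)
  with refl ← ↭-empty-inv ρ | refl ← ↭-empty-inv σ
     | refl ← ↭-singleton-inv τ = ⊃R-inv d
⊃R-inv (⊃R _ d) = _ , d

module _ (I : Interpolant V₁ V₂ _≡_ ｛ left , zero ∶ A ｝ ｛ right , zero ∶ B ｝) where

  collapsed : List Clause
  collapsed = map collapse (I .clauses)

  craig : Formula
  craig = conjunction collapsed

  craig-var : var craig ⊆ V₁ ∩ V₂
  craig-var = conjunction-var (All.map⁺ (All.map collapse-Over (I .over)))

  -- All labels can be identified because the relation of I is equality.
  collapsed-proof₁ : Θ (left , zero ∶ A) → Any (All Θ) collapsed → E ⊩ Θ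
  collapsed-proof₁ l h = ⊩-relabel (const zero) (λ _ → ε) (λ θ → θ)
    (I .proof₁ (λ { refl → l }) (Any.map All.map⁻ (Any.map⁻ h)))

  collapsed-proof₂ : Θ (right , zero ∶ B) → All (Refutes Θ) collapsed → E ⊩ Θ
  collapsed-proof₂ r hs = ⊩-relabel (const zero) (λ _ → ε) (λ θ → θ)
    (I .proof₂ (λ { refl → r })
      (All.map (Any.map (λ { {_ , _ ∶ _} θ → θ }) ∘ Any.map⁻) (All.map⁻ hs)))

  craig₁ : _≡_ ⊩ ｛ left , zero ∶ A ｝ ∪ ｛ right , zero ∶ craig ｝
  craig₁ = prove-conjunction collapsed (inj₂ refl) λ i sub r →
    let c , j , eq = ∈-map⁻ collapse i in
    -- The fresh label is index 0 and the root becomes 1; `up` copies `A` to index 0, where the two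
    -- parts of the conjunct also lie.
    ⊩-fresh right r (⊩-monl up (inj₂ (sub (inj₁ refl)))
      (assume _ {∅} (inj₂ (inj₁ (inj₁ refl))) (inj₂ (inj₁ (inj₂ refl))) (λ { {_ , suc _ ∶ _} () })
        (subst (All ∅ ∘ lower) (sym eq) (lower-collapse c))
        λ sub′ ψs → collapsed-proof₁ (sub′ (inj₁ refl)) (lose i ψs)))

  craig₂ : _≡_ ⊩ ｛ left , zero ∶ craig ｝ ∪ ｛ right , zero ∶ B ｝
  craig₂ = assume-conjunction collapsed (inj₁ refl) λ sub ψs →
    -- The implications are used at the root itself, so `step` copies along a reflexive edge.
    refute-all right (⊩-monl refl) collapsed (All.map inj₂ ψs)
      λ sub′ → collapsed-proof₂ (sub′ (sub (inj₂ refl)))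

theorem30 : (x : Label) (A B : Formula) →
    Provable ([] ∣ [] ⊢ [ x ∶ A ⊃ B ]) →
    ∃[ C ] (var C ⊆ var A ∩ var B
    × Provable ([] ∣ [] ⊢ [ x ∶ A ⊃ C ])
    × Provable ([] ∣ [] ⊢ [ x ∶ C ⊃ B ]))
theorem30 x A B d with y , d′ ← ⊃R-inv d =
  craig I , craig-var I , ⊩⇒Provable (craig₁ I) , ⊩⇒Provable (craig₂ I)
  where
  I : Interpolant (var A) (var B) _≡_ ｛ left , zero ∶ A ｝ ｛ right , zero ∶ B ｝
  -- Both `x` and `y` go to index 0, which turns the edge between them into an instance of equality.
  I = interpolate {f = const zero} d′
    (split (refl ∷ []) (in₁ (refl , λ v → v) ∷ []) (in₂ (refl , λ v → v) ∷ []))
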